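{- Let $k \geq 2$ and let $\Sigma_k$ be an alphabet with $k$ letters. For $n \ge 0$ let $p_k(n)$ be the number of palstars of length $2n$ over $\Sigma_k$ and $u_k(n)$ the number of unbordered strings of length $n$ over $\Sigma_k$, and define the formal power series $P_k(X) = \sum_{n \geq 0} p_k(n) X^n$ and $U_k(X) = \sum_{n\geq 0} u_k(n) X^n$. Then $$P_k(X) = \frac{1}{2 - U_k(X)}.$$
   Context: Let $P = \{ x x^R : x \in \Sigma_k^+\}$ be the set of nonempty even-length palindromes over $\Sigma_k$ (here $x^R$ is the reversal of $x$). A palstar is an element of $P^* = \bigcup_{i\ge 0} P^i$, i.e. a (possibly empty) concatenation of nonempty even-length palindromes; the empty string is a palstar, so $p_k(0)=1$. A nonempty string $x$ is a border of a string $y$ if $x \neq y$ and $x$ is both a prefix and a suffix of $y$; $y$ is unbordered if it has no border (so the empty string is unbordered and $u_k(0)=1$). -}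

module Defs where

open import Algebra.Definitions using (Invertible)
open import Algebra.Properties.Monoid.Sum using (sum⁺-syntax)
open import Data.Fin.Base using (Fin; toℕ)
open import Data.Fin.Properties using (_≟_)
open import Data.Integer.Base as ℤ using (ℤ; +_; 0ℤ; 1ℤ)
open import Data.Integer.Properties as ℤ using ()
open import Data.List.Base using (List; []; _∷_; _++_; [_]; length; reverse; concat; filter; allFin; cartesianProductWith)
open import Data.List.Properties using (≡-dec; length-++)
open import Data.List.Relation.Binary.Prefix.Heterogeneous as Prefix using (Prefix)
open import Data.List.Relation.Binary.Prefix.Heterogeneous.Properties using (prefix?)
open import Data.List.Relation.Binary.Suffix.Heterogeneous using (Suffix)
open import Data.List.Relation.Binary.Suffix.Heterogeneous.Properties using (suffix?)
open import Data.List.Relation.Unary.All using (All; []; _∷_)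
open import Data.Nat.Base using (ℕ; zero; suc; _*_; _∸_; _≤_; s≤s; s≤s⁻¹)
open import Data.Nat.Properties using (≤-refl; ≤-trans; m≤n+m)
open import Data.Product.Base using (∃-syntax; _×_; _,_; proj₁; proj₂)
open import Data.Sum.Base using (_⊎_; inj₁; inj₂)
open import Level using (0ℓ)
open import Relation.Binary.PropositionalEquality using (_≡_; _≢_; refl; sym; cong; subst)
open import Relation.Nullary using (Dec; yes; no; ¬_; ¬?)
open import Relation.Nullary.Decidable using (map′; _×-dec_; _⊎-dec_)
open import Relation.Unary using (Pred; Decidable)

Word : ℕ → Set
Word k = List (Fin k)

NonemptyEvenPalindrome : ∀ {k} → Pred (Word k) 0ℓ
NonemptyEvenPalindrome {k} w = ∃[ x ] x ≢ [] × x ++ reverse x ≡ w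

Palstar : ∀ {k} → Pred (Word k) 0ℓ
Palstar {k} w = ∃[ ws ] All NonemptyEvenPalindrome ws × concat ws ≡ w

Border : ∀ {k} → Word k → Word k → Set
Border x y = x ≢ [] × x ≢ y × Prefix _≡_ x y × Suffix _≡_ x y

Unbordered : ∀ {k} → Pred (Word k) 0ℓ
Unbordered y = ¬ (∃[ x ] Border x y)

private
  _≟ʷ_ : ∀ {k} (x y : Word k) → Dec (x ≡ y)
  _≟ʷ_ = ≡-dec _≟_

  split? : ∀ {k} (w : Word k) {R : Word k → Word k → Set} →
           (∀ u v → u ++ v ≡ w → Dec (R u v)) →
           Dec (∃[ u ] ∃[ v ] (u ++ v ≡ w × R u v))
  split? [] R? = map′
    (λ r → [] , [] , refl , r)
    (λ { ([] , [] , refl , r) → r })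
    (R? [] [] refl)
  split? (a ∷ w) {R} R? = map′
    (λ { (inj₁ r) → [] , a ∷ w , refl , r
       ; (inj₂ (u , v , eq , r)) → a ∷ u , v , cong (a ∷_) eq , r })
    (λ { ([] , _ , refl , r) → inj₁ r
       ; (_ ∷ u , v , refl , r) → inj₂ (u , v , refl , r) })
    (R? [] (a ∷ w) refl
      ⊎-dec split? w {λ u v → R (a ∷ u) v} (λ u v eq → R? (a ∷ u) v (cong (a ∷_) eq)))

  prefix⇒++ : ∀ {k} {x y : Word k} → Prefix _≡_ x y → ∃[ v ] x ++ v ≡ y
  prefix⇒++ Prefix.[] = _ , refl
  prefix⇒++ (refl Prefix.∷ p) with v , refl ← prefix⇒++ p = v , refl

nonemptyEvenPalindrome? : ∀ {k} → Decidable (NonemptyEvenPalindrome {k})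
nonemptyEvenPalindrome? w = map′
  (λ { (x , _ , eq , x≢[] , refl) → x , x≢[] , eq })
  (λ { (x , x≢[] , eq) → x , reverse x , eq , x≢[] , refl })
  (split? w λ x v _ → ¬? (x ≟ʷ []) ×-dec (v ≟ʷ reverse x))

private
  palindrome≢[] : ∀ {k} {w : Word k} → NonemptyEvenPalindrome w → w ≢ []
  palindrome≢[] ([] , x≢[] , _) _ = x≢[] refl
  palindrome≢[] (_ ∷ _ , _ , refl) ()

  palstar-[] : ∀ {k} → Palstar {k} []
  palstar-[] = [] , [] , refl

  palstar-++ : ∀ {k} {u v : Word k} → NonemptyEvenPalindrome u → Palstar v → Palstar (u ++ v)
  palstar-++ {u = u} pu (ws , pws , eq) = u ∷ ws , pu ∷ pws , cong (u ++_) eq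

  -- The first argument bounds the length of the word, for termination.
  palstar?′ : ∀ {k} n (w : Word k) → length w ≤ n → Dec (Palstar w)
  palstar?′ _ [] _ = yes palstar-[]
  palstar?′ {k} (suc n) w@(_ ∷ _) |w|≤1+n = map′
    (λ { (_ , _ , eq , pu , pv) → subst Palstar eq (palstar-++ pu pv) })
    (λ { ([] , _ , ())
       ; (u ∷ us , pu ∷ pus , eq) → u , concat us , eq , pu , (us , pus , refl) })
    (split? w R?)
    where
    R? : ∀ u v → u ++ v ≡ w → Dec (NonemptyEvenPalindrome u × Palstar v)
    R? [] v _ = no λ { (p , _) → palindrome≢[] p refl }
    R? (a ∷ u) v eq = nonemptyEvenPalindrome? (a ∷ u) ×-dec palstar?′ n v |v|≤n
      where
      |v|≤n : length v ≤ n
      |v|≤n = s≤s⁻¹ (≤-trans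
        (s≤s (subst (length v ≤_) (sym (length-++ u)) (m≤n+m (length v) (length u))))
        (subst (λ z → length z ≤ suc n) (sym eq) |w|≤1+n))

palstar? : ∀ {k} → Decidable (Palstar {k})
palstar? w = palstar?′ (length w) w ≤-refl

border? : ∀ {k} (x y : Word k) → Dec (Border x y)
border? x y = ¬? (x ≟ʷ []) ×-dec ¬? (x ≟ʷ y) ×-dec prefix? _≟_ x y ×-dec suffix? _≟_ x y

unbordered? : ∀ {k} → Decidable (Unbordered {k})
unbordered? y = ¬? (map′
  (λ { (x , _ , _ , b) → x , b })
  (λ { (x , b@(_ , _ , p , _)) → x , proj₁ (prefix⇒++ p) , proj₂ (prefix⇒++ p) , b })
  (split? y λ x _ _ → border? x y))

-- Every word of length n over Fin k, each listed exactly once.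
words : ∀ k → ℕ → List (Word k)
words k zero    = [ [] ]
words k (suc n) = cartesianProductWith _∷_ (allFin k) (words k n)

count : ∀ {k} {P : Pred (Word k) 0ℓ} → Decidable P → ℕ → ℕ
count {k} P? n = length (filter P? (words k n))

p : ℕ → ℕ → ℕ
p k n = count {k} palstar? (2 * n)

u : ℕ → ℕ → ℕ
u k n = count {k} unbordered? n

-- ℤ[[X]], a series being given by its coefficients.
PowerSeries : Set
PowerSeries = ℕ → ℤ

infix  4 _≈_
infixl 6 _-_
infixl 7 _⊛_

_≈_ : PowerSeries → PowerSeries → Set
F ≈ G = ∀ n → F n ≡ G n

const : ℤ → PowerSeries
const c zero    = c
const c (suc _) = 0ℤ

_-_ : PowerSeries → PowerSeries → PowerSeries
(F - G) n = F n ℤ.- G n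

_⊛_ : PowerSeries → PowerSeries → PowerSeries
(F ⊛ G) n = sum⁺-syntax ℤ.+-0-monoid n λ i → F (toℕ i) ℤ.* G (n ∸ toℕ i)

IsUnit : PowerSeries → Set
IsUnit = Invertible _≈_ (const 1ℤ) _⊛_

-- Inverses in ℤ[[X]] are unique up to _≈_, so the value does not depend on the
-- proof of invertibility.
1/ : (F : PowerSeries) → IsUnit F → PowerSeries
1/ F (F⁻¹ , _) = F⁻¹

P : ℕ → PowerSeries
P k n = + p k n

U : ℕ → PowerSeries
U k n = + u k n

{-# OPTIONS --safe #-}
module Submission where

-- Both unbordered words and halves of prime palstars arise from a rule turning a
-- nonempty word y and a word z into a longer word starting with y: either y z y or
-- y yᴿ z.  Call a word free if it is not obtained by the rule.  Free for the first
-- rule means unbordered (a bordered word has a border that does not overlap itself);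
-- free for the second means having no nonempty even palindrome as a prefix.  For both
-- rules every word that is not free comes from exactly one pair (y , z) with y free
-- and nonempty, so the numbers f(n) of free words satisfy the same recurrence
-- kⁿ = f(n) + Σ f(i) kⁿ⁻²ⁱ over 1 ≤ i ≤ n/2, and hence agree.  A nonempty palstar is
-- uniquely y yᴿ z with y ≠ [] free for the second rule and z a palstar, which gives
-- p(n) = Σ u(i) p(n − i) over 1 ≤ i ≤ n, that is, (2 − U) P = 1.

open import Defs
open import Algebra.Properties.CommutativeMonoid.Sum using (sum-permute)
open import Algebra.Properties.Monoid.Sum using (sum-cong-≗)
import Algebra.Definitions.RawMonoid as RawMonoid
open import Data.Empty using (⊥-elim)
open import Data.Fin.Base using (Fin; toℕ)
import Data.Fin.Permutation as Perm
open import Data.Fin.Properties using (opposite-prop; toℕ≤pred[n])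
import Data.Fin.Properties as Fin
open import Data.Integer.Base as ℤ using (ℤ; 0ℤ; 1ℤ)
import Data.Integer.Properties as ℤ
open import Data.List.Base using (List; []; _∷_; _++_; length; reverse; concat; filter; map; applyUpTo; allFin; cartesianProduct)
open import Data.List.Membership.Propositional using (_∈_; find; lose)
open import Data.List.Membership.Propositional.Properties using (∈-allFin; ∈-applyUpTo⁺; ∈-applyUpTo⁻; ∈-cartesianProduct⁺; ∈-cartesianProduct⁻; ∈-cartesianProductWith⁺; ∈-cartesianProductWith⁻; ∈-concat⁺′; ∈-concat⁻′; ∈-filter⁺; ∈-filter⁻; ∈-map⁺; ∈-map⁻)
open import Data.List.Membership.Propositional.Properties.WithK using (unique∧set⇒bag)
open import Data.List.Properties using (++-assoc; ++-cancelˡ; ++-cancelʳ; ++-identityʳ; ++-monoid; ∷-injective; filter-≐; length-++; length-map; length-reverse; reverse-++; reverse-involutive; ≡-dec)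
open import Data.List.Relation.Binary.BagAndSetEquality using (∼bag⇒↭)
open import Data.List.Relation.Binary.Permutation.Propositional.Properties using (↭-length)
open import Data.List.Relation.Binary.Pointwise using (Pointwise-≡⇒≡; ≡⇒Pointwise-≡)
import Data.List.Relation.Binary.Prefix.Heterogeneous as Prefix
import Data.List.Relation.Binary.Suffix.Heterogeneous as Suffix
open import Data.List.Relation.Unary.All using ([]; _∷_)
import Data.List.Relation.Unary.All as All
import Data.List.Relation.Unary.All.Properties as All
open import Data.List.Relation.Unary.AllPairs using ([]; _∷_)
import Data.List.Relation.Unary.AllPairs.Properties as AllPairs
open import Data.List.Relation.Unary.Any using (any?; here; there)
open import Data.List.Relation.Unary.Unique.Propositional using (Unique)
import Data.List.Relation.Unary.Unique.Propositional.Properties as Unique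
open import Data.Nat.Base using (ℕ; zero; suc; _+_; _*_; _∸_; _<_; _≤_; s≤s; z≤n; ⌊_/2⌋)
open import Data.Nat.Induction using (Acc; acc; <-wellFounded; <-rec)
open import Data.Nat.ListAction using (sum)
open import Data.Nat.Properties
open import Data.Product.Base using (Σ-syntax; ∃; ∃₂; ∃-syntax; _×_; _,_; proj₁; proj₂; map₁; map₂; uncurry)
open import Data.Sum.Base as Sum using (_⊎_; inj₁; inj₂)
open import Data.Unit.Base using (tt)
open import Function.Base using (_∘_; _$_)
open import Function.Bundles using (_⇔_; mk⇔; Equivalence)
open import Level using (0ℓ)
open import Relation.Binary.PropositionalEquality using (_≡_; _≢_; refl; sym; trans; cong; cong₂; subst; module ≡-Reasoning)
open import Relation.Nullary using (Dec; yes; no; ¬_; ¬?)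
open import Relation.Nullary.Decidable using (map′; _×-dec_)
open import Relation.Unary using (Pred; Decidable)
open import Relation.Unary.Properties using (U?)
open import Tactic.MonoidSolver using (solve)

private variable
  k : ℕ
  A B : Set

-- Lists

-- Levi's lemma for the free monoid. The overlap arguments below all compare two factorisations of
-- one word through it.
levi : ∀ (as cs : List A) {bs ds} → as ++ bs ≡ cs ++ ds →
       (∃ λ rs → cs ≡ as ++ rs × bs ≡ rs ++ ds) ⊎ (∃ λ rs → as ≡ cs ++ rs × ds ≡ rs ++ bs)
levi []       cs       eq = inj₁ (cs , refl , eq)
levi (a ∷ as) []       eq = inj₂ (a ∷ as , refl , sym eq)
levi (a ∷ as) (_ ∷ cs) eq with refl , eq′ ← ∷-injective eq =
  Sum.map (map₂ (map₁ (cong (a ∷_)))) (map₂ (map₁ (cong (a ∷_)))) (levi as cs eq′)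

unique-map⁺ : {f : A → B} (xs : List A) →
              (∀ {x y} → x ∈ xs → y ∈ xs → f x ≡ f y → x ≡ y) → Unique xs → Unique (map f xs)
unique-map⁺ []       inj []            = []
unique-map⁺ (x ∷ xs) inj (x∉xs ∷ xs!) =
  All.map⁺ (All.tabulate λ y∈xs fx≡fy → All.lookup x∉xs y∈xs (inj (here refl) (there y∈xs) fx≡fy))
  ∷ unique-map⁺ xs (λ x∈ y∈ → inj (there x∈) (there y∈)) xs!

-- Without repetitions every multiplicity is at most one, so equal sets are equal bags. Counting by
-- a bijection thereby reduces to two inclusions.
unique-set⇒length : {xs ys : List A} → Unique xs → Unique ys →
                    (∀ {x} → x ∈ xs ⇔ x ∈ ys) → length xs ≡ length ys
unique-set⇒length xs! ys! eq = ↭-length (∼bag⇒↭ (unique∧set⇒bag xs! ys! eq))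

length-concat-applyUpTo : ∀ (f : ℕ → List A) n → length (concat (applyUpTo f n)) ≡ sum (applyUpTo (length ∘ f) n)
length-concat-applyUpTo f zero    = refl
length-concat-applyUpTo f (suc n) =
  trans (length-++ (f 0)) (cong (length (f 0) +_) (length-concat-applyUpTo (f ∘ suc) n))

length-cartesianProduct : ∀ (xs : List A) (ys : List B) → length (cartesianProduct xs ys) ≡ length xs * length ys
length-cartesianProduct []       ys = refl
length-cartesianProduct (x ∷ xs) ys =
  trans (length-++ (map (x ,_) ys)) (cong₂ _+_ (length-map (x ,_) ys) (length-cartesianProduct xs ys))

length-filter-¬ : {P : Pred A 0ℓ} (P? : Decidable P) (xs : List A) →
                  length (filter (¬? ∘ P?) xs) + length (filter P? xs) ≡ length xs
length-filter-¬ P? []       = refl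
length-filter-¬ P? (x ∷ xs) with P? x
... | yes _ = trans (+-suc _ _) (cong suc (length-filter-¬ P? xs))
... | no  _ = cong suc (length-filter-¬ P? xs)

sum-applyUpTo-cong : ∀ {f g : ℕ → ℕ} n → (∀ {i} → i < n → f i ≡ g i) → sum (applyUpTo f n) ≡ sum (applyUpTo g n)
sum-applyUpTo-cong zero    f≡g = refl
sum-applyUpTo-cong (suc n) f≡g = cong₂ _+_ (f≡g (s≤s z≤n)) (sum-applyUpTo-cong n (f≡g ∘ s≤s))

-- Enumerations of words

∈-words⁺ : ∀ {n} (w : Word k) → length w ≡ n → w ∈ words k n
∈-words⁺ []      refl = here refl
∈-words⁺ (a ∷ w) refl = ∈-cartesianProductWith⁺ _∷_ (∈-allFin a) (∈-words⁺ w refl)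

∈-words⁻ : ∀ n {w : Word k} → w ∈ words k n → length w ≡ n
∈-words⁻ zero    (here refl) = refl
∈-words⁻ {k} (suc n) w∈ with _ , _ , _ , v∈ , refl ← ∈-cartesianProductWith⁻ _∷_ (allFin k) (words k n) w∈ =
  cong suc (∈-words⁻ n v∈)

words-unique : ∀ n → Unique (words k n)
words-unique     zero    = [] ∷ []
words-unique {k} (suc n) = Unique.cartesianProductWith⁺ _∷_ ∷-injective (Unique.allFin⁺ k) (words-unique n)

anyWord? : {P : Pred (Word k) 0ℓ} → Decidable P → ∀ n → Dec (∃[ w ] length w ≡ n × P w)
anyWord? {k} P? n = map′
  (λ a → let w , w∈ , pw = find a in w , ∈-words⁻ n w∈ , pw)
  (λ { (w , |w|≡n , pw) → lose (∈-words⁺ w |w|≡n) pw })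
  (any? P? (words k n))

module _ {P : Pred (Word k) 0ℓ} (P? : Decidable P) where

  matches : ℕ → List (Word k)
  matches n = filter P? (words k n)

  matches-unique : ∀ n → Unique (matches n)
  matches-unique n = Unique.filter⁺ P? (words-unique n)

  ∈-matches⁺ : ∀ {n w} → length w ≡ n → P w → w ∈ matches n
  ∈-matches⁺ {w = w} |w|≡n pw = ∈-filter⁺ P? (∈-words⁺ w |w|≡n) pw

  ∈-matches⁻ : ∀ {n w} → w ∈ matches n → length w ≡ n × P w
  ∈-matches⁻ {n} w∈ = map₁ (∈-words⁻ n) (∈-filter⁻ P? w∈)

length≢0 : {w : Word k} {n : ℕ} → length w ≡ suc n → w ≢ []
length≢0 () refl

length-suc : {w : Word k} → w ≢ [] → ∃[ n ] length w ≡ suc n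
length-suc {w = []}    w≢[] = ⊥-elim (w≢[] refl)
length-suc {w = _ ∷ w} _    = length w , refl

length-++-<ʳ : ∀ (t : Word k) {y} → t ≢ [] → length y < length (t ++ y)
length-++-<ʳ t t≢[] with n , |t|≡1+n ← length-suc t≢[] =
  subst (_ <_) (sym (trans (length-++ t) (cong (_+ _) |t|≡1+n))) (s≤s (m≤n+m _ n))

length-++-<ˡ : ∀ (y : Word k) {s} → s ≢ [] → length y < length (y ++ s)
length-++-<ˡ y s≢[] with n , |s|≡1+n ← length-suc s≢[] =
  subst (_ <_) (sym (trans (length-++ y) (cong (length y +_) |s|≡1+n))) (m<m+n _ (s≤s z≤n))

-- Splittings

Splits : (Word k → Word k → Word k) → Pred (Word k) 0ℓ
Splits rest w = ∃₂ λ y z → y ≢ [] × y ++ rest y z ≡ w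

-- `nested` serves existence of a free first factor: a first factor x of y can replace y.
-- `overlapping` serves uniqueness: of two distinct nonempty first factors of a word, the longer one
-- is not free. `rest-length` gives every rule the same length 2|y| + |z|, which makes the counts
-- for different rules comparable.
record Splitting (k : ℕ) : Set where
  field
    rest           : Word k → Word k → Word k
    rest-length    : ∀ y z → length (rest y z) ≡ length y + length z
    rest-injective : ∀ y {z z′} → rest y z ≡ rest y z′ → z ≡ z′
    nested         : ∀ x z z′ → let y = x ++ rest x z in ∃[ z″ ] x ++ rest x z″ ≡ y ++ rest y z′
    overlapping    : ∀ y s {z z′} → y ≢ [] → s ≢ [] →
                     y ++ rest y z ≡ (y ++ s) ++ rest (y ++ s) z′ → Splits rest (y ++ s)

  Free : Pred (Word k) 0ℓ
  Free w = ¬ Splits rest w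

  split-length : ∀ y z → length (y ++ rest y z) ≡ length y + (length y + length z)
  split-length y z = trans (length-++ y) (cong (length y +_) (rest-length y z))

  splits? : Decidable (Splits rest)
  splits? w = map′
    (λ { (_ , _ , y , _ , z , _ , y≢[] , eq) → y , z , y≢[] , eq })
    (λ { (y , z , y≢[] , refl) →
           length y , s≤s (subst (length y ≤_) (sym (length-++ y)) (m≤m+n _ _)) ,
           y , refl , z , z-length y z , y≢[] , refl })
    -- The length m of y determines that of z. If m + m exceeds `length w`, truncated subtraction
    -- tries the empty z, and the equality test fails because the product is too long.
    (anyUpTo? (λ m → anyWord? (λ y → anyWord? (λ z →
       ¬? (≡-dec Fin._≟_ y []) ×-dec ≡-dec Fin._≟_ (y ++ rest y z) w)
       (length w ∸ (m + m))) m) (suc (length w)))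
    where
    z-length : ∀ y z → length z ≡ length (y ++ rest y z) ∸ (length y + length y)
    z-length y z = sym $ begin
      length (y ++ rest y z) ∸ (length y + length y)           ≡⟨ cong (_∸ (length y + length y)) (split-length y z) ⟩
      length y + (length y + length z) ∸ (length y + length y) ≡⟨ cong (_∸ (length y + length y)) (+-assoc (length y) _ _) ⟨
      length y + length y + length z ∸ (length y + length y)   ≡⟨ m+n∸m≡n (length y + length y) _ ⟩
      length z                                                 ∎
      where open ≡-Reasoning

  free? : Decidable Free
  free? = ¬? ∘ splits?

  length-factor-< : ∀ y z → y ≢ [] → length y < length (y ++ rest y z)
  length-factor-< y z y≢[] with n , |y|≡1+n ← length-suc y≢[] =
    subst (length y <_) (sym (split-length y z))
      (m<m+n (length y) (≤-trans (subst (0 <_) (sym |y|≡1+n) (s≤s z≤n)) (m≤m+n _ _)))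

  -- Descent on the length of the first factor: if y is not free, `nested` makes its own first
  -- factor x, which is strictly shorter, a first factor of the whole word.
  splits⇒free : ∀ {w} → Splits rest w → ∃₂ λ y z → y ≢ [] × Free y × y ++ rest y z ≡ w
  splits⇒free (y , z , y≢[] , refl) = go y z (<-wellFounded _) y≢[]
    where
    go : ∀ y z → Acc _<_ (length y) → y ≢ [] →
         ∃₂ λ y′ z′ → y′ ≢ [] × Free y′ × y′ ++ rest y′ z′ ≡ y ++ rest y z
    go y z (acc rs) y≢[] with splits? y
    ... | no  free = y , z , y≢[] , free , refl
    ... | yes (x , t , x≢[] , refl) with z″ , eq ← nested x t z
        with y′ , z′ , y′≢[] , free , eq′ ← go x z″ (rs (length-factor-< x t x≢[])) x≢[] =
      y′ , z′ , y′≢[] , free , trans eq′ eq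

  prefix-unique : ∀ {y y′ s z z′} → y ≢ [] → Free y′ → y′ ≡ y ++ s →
                  y ++ rest y z ≡ y′ ++ rest y′ z′ → y ≡ y′
  prefix-unique {y} {s = []}    y≢[] free refl eq = sym (++-identityʳ y)
  prefix-unique {y} {s = a ∷ s} y≢[] free refl eq = ⊥-elim (free (overlapping y (a ∷ s) y≢[] (λ ()) eq))

  -- Both y and y′ are prefixes of the same word, so one extends the other. A proper extension would
  -- split by `overlapping`, against its freeness; cancellation then identifies z and z′.
  free-unique : ∀ {y y′ z z′} → y ≢ [] → y′ ≢ [] → Free y → Free y′ →
                y ++ rest y z ≡ y′ ++ rest y′ z′ → y ≡ y′ × z ≡ z′
  free-unique {y} {y′} {z} {z′} y≢[] y′≢[] free free′ eq with y≡y′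
    where
    y≡y′ : y ≡ y′
    y≡y′ with levi y y′ eq
    ... | inj₁ (_ , y′≡ys , _) = prefix-unique y≢[] free′ y′≡ys eq
    ... | inj₂ (_ , y≡y′s , _) = sym (prefix-unique y′≢[] free y≡y′s (sym eq))
  ... | refl = refl , rest-injective y (++-cancelˡ y _ _ eq)

  -- The product (y , z) ↦ `y ++ rest y z` is injective on free nonempty y by `free-unique`, so the
  -- words in `R` are counted by pairs, grouped by the length of y. The index i stands for length
  -- `suc i`, which excludes the empty y; `sizes` says that `ℓ i` is the matching length of z and
  -- that i < m describes all possible lengths.
  count-factorised :
    {Q R : Pred (Word k) 0ℓ} (Q? : Decidable Q) (R? : Decidable R) (N m : ℕ) (ℓ : ℕ → ℕ) →
    (∀ {w} → length w ≡ N → R w → ∃₂ λ y z → y ≢ [] × Free y × Q z × y ++ rest y z ≡ w) →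
    (∀ y z → y ≢ [] → Free y → Q z → R (y ++ rest y z)) →
    (∀ i l → (i < m × l ≡ ℓ i) ⇔ suc i + (suc i + l) ≡ N) →
    count R? N ≡ sum (applyUpTo (λ i → count free? (suc i) * count Q? (ℓ i)) m)
  count-factorised {Q} {R} Q? R? N m ℓ factor compose sizes = begin
    length (matches R? N)                              ≡⟨ unique-set⇒length (matches-unique R? N) products-unique (mk⇔ to from) ⟩
    length (map join pairs)                            ≡⟨ length-map join pairs ⟩
    length pairs                                       ≡⟨ length-concat-applyUpTo block m ⟩
    sum (applyUpTo (length ∘ block) m)                 ≡⟨ sum-applyUpTo-cong m (λ {i} _ → length-cartesianProduct (matches free? (suc i)) _) ⟩
    sum (applyUpTo (λ i → count free? (suc i) * count Q? (ℓ i)) m) ∎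
    where
    open ≡-Reasoning

    join : Word k × Word k → Word k
    join (y , z) = y ++ rest y z

    block : ℕ → List (Word k × Word k)
    block i = cartesianProduct (matches free? (suc i)) (matches Q? (ℓ i))

    pairs : List (Word k × Word k)
    pairs = concat (applyUpTo block m)

    ∈-block⁻ : ∀ i {y z} → (y , z) ∈ block i → (length y ≡ suc i × Free y) × (length z ≡ ℓ i × Q z)
    ∈-block⁻ i yz∈ with y∈ , z∈ ← ∈-cartesianProduct⁻ (matches free? (suc i)) (matches Q? (ℓ i)) yz∈ =
      ∈-matches⁻ free? {suc i} y∈ , ∈-matches⁻ Q? {ℓ i} z∈

    ∈-pairs⁻ : ∀ {y z} → (y , z) ∈ pairs → ∃[ i ] i < m × (length y ≡ suc i × Free y) × (length z ≡ ℓ i × Q z)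
    ∈-pairs⁻ yz∈ with _ , yz∈b , b∈ ← ∈-concat⁻′ (applyUpTo block m) yz∈
        with i , i<m , refl ← ∈-applyUpTo⁻ block b∈ = i , i<m , ∈-block⁻ i yz∈b

    pairs-unique : Unique pairs
    pairs-unique = Unique.concat⁺
      (All.applyUpTo⁺₂ block m λ i →
        Unique.cartesianProduct⁺ (matches-unique free? (suc i)) (matches-unique Q? (ℓ i)))
      (AllPairs.applyUpTo⁺₁ block m λ {i} {j} i<j _ (∈i , ∈j) →
        let (|y|≡1+i , _) , _ = ∈-block⁻ i ∈i
            (|y|≡1+j , _) , _ = ∈-block⁻ j ∈j
        in <⇒≢ i<j (suc-injective (trans (sym |y|≡1+i) |y|≡1+j)))

    products-unique : Unique (map join pairs)
    products-unique = unique-map⁺ pairs injective pairs-unique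
      where
      injective : ∀ {x y} → x ∈ pairs → y ∈ pairs → join x ≡ join y → x ≡ y
      injective x∈ y∈ eq with _ , _ , (|x| , free-x) , _ ← ∈-pairs⁻ x∈ | _ , _ , (|y| , free-y) , _ ← ∈-pairs⁻ y∈ =
        uncurry (cong₂ _,_) (free-unique (length≢0 |x|) (length≢0 |y|) free-x free-y eq)

    to : ∀ {w} → w ∈ matches R? N → w ∈ map join pairs
    to w∈ with |w|≡N , rw ← ∈-matches⁻ R? {N} w∈ with y , z , y≢[] , free , qz , refl ← factor |w|≡N rw
        with i , |y|≡1+i ← length-suc y≢[]
        with i<m , |z|≡ℓi ← Equivalence.from (sizes i (length z))
               (subst (λ h → h + (h + length z) ≡ N) |y|≡1+i (trans (sym (split-length y z)) |w|≡N)) =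
      ∈-map⁺ join (∈-concat⁺′
        (∈-cartesianProduct⁺ (∈-matches⁺ free? |y|≡1+i free) (∈-matches⁺ Q? |z|≡ℓi qz))
        (∈-applyUpTo⁺ block i<m))

    from : ∀ {w} → w ∈ map join pairs → w ∈ matches R? N
    from w∈ with (y , z) , yz∈ , refl ← ∈-map⁻ join w∈
        with i , i<m , (|y|≡1+i , free) , |z|≡ℓi , qz ← ∈-pairs⁻ yz∈ =
      ∈-matches⁺ R?
        (trans (split-length y z)
          (subst (λ h → h + (h + length z) ≡ N) (sym |y|≡1+i) (Equivalence.to (sizes i (length z)) (i<m , |z|≡ℓi))))
        (compose y z (length≢0 |y|≡1+i) free qz)

  -- Only count free? depends on rest here, so this recurrence determines the
  -- number of free words of each length.
  count-words : ∀ n → count free? n + sum (applyUpTo (λ i → count free? (suc i) * count {k} U? (n ∸ (suc i + suc i))) ⌊ n /2⌋)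
                      ≡ length (words k n)
  count-words n = trans
    (cong (count free? n +_) (sym (count-factorised U? splits? n ⌊ n /2⌋ (λ i → n ∸ (suc i + suc i))
      (λ _ s → let y , z , y≢[] , free , eq = splits⇒free s in y , z , y≢[] , free , tt , eq)
      (λ y z y≢[] _ _ → y , z , y≢[] , refl)
      (λ i l → mk⇔ (to i l) (from i l)))))
    (length-filter-¬ splits? (words k n))
    where
    to : ∀ i l → i < ⌊ n /2⌋ × l ≡ n ∸ (suc i + suc i) → suc i + (suc i + l) ≡ n
    to i _ (i<⌊n/2⌋ , refl) = trans (sym (+-assoc (suc i) (suc i) _)) (m+[n∸m]≡n
      (≤-trans (+-mono-≤ i<⌊n/2⌋ (≤-trans i<⌊n/2⌋ (⌊n/2⌋≤⌈n/2⌉ n))) (≤-reflexive (⌊n/2⌋+⌈n/2⌉≡n n))))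

    from : ∀ i l → suc i + (suc i + l) ≡ n → i < ⌊ n /2⌋ × l ≡ n ∸ (suc i + suc i)
    from i l eq rewrite sym (+-assoc (suc i) (suc i) l) | sym eq =
      subst (_≤ ⌊ suc i + suc i + l /2⌋) (sym (n≡⌊n+n/2⌋ (suc i))) (⌊n/2⌋-mono (m≤m+n (suc i + suc i) l)) ,
      sym (m+n∸m≡n (suc i + suc i) l)

open Splitting using (Free; free?; count-words)

-- Strong induction on n: the sums in the two recurrences involve only lengths `suc i` with i <
-- ⌊n/2⌋, all below n, so they agree and cancel.
count-free-unique : (S T : Splitting k) → ∀ n → count (free? S) n ≡ count (free? T) n
count-free-unique {k} S T = <-rec _ λ n ih → +-cancelʳ-≡ _ _ _ (trans (count-words S n) (sym (trans
  (cong (count (free? T) n +_) (sum-applyUpTo-cong ⌊ n /2⌋ λ {i} i<⌊n/2⌋ →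
    cong (_* count {k} U? (n ∸ (suc i + suc i))) (ih-at n ih i i<⌊n/2⌋)))
  (count-words T n))))
  where
  ih-at : ∀ n → (∀ {m} → m < n → count (free? S) m ≡ count (free? T) m) →
          ∀ i → i < ⌊ n /2⌋ → count (free? S) (suc i) ≡ count (free? T) (suc i)
  -- For lengths 0 and 1 the sum is empty, so no i remains.
  ih-at (suc (suc n)) ih i i<⌊n/2⌋ = ih (s≤s (≤-trans i<⌊n/2⌋ (s≤s (⌊n/2⌋≤n n))))

-- Borders

-- The equation makes y a border of `y ++ s`. If y is not longer than t, its two occurrences do not
-- overlap. Otherwise y = t r = r s: either r is empty and the word is y y, or r is a shorter border
-- of y and the induction applies to it.
conjugate⇒splits : ∀ (t y s : Word k) → Acc _<_ (length y) → y ≢ [] → t ≢ [] → t ++ y ≡ y ++ s →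
                   Splits (λ x z → z ++ x) (y ++ s)
conjugate⇒splits {k} t y s (acc rs) y≢[] t≢[] eq with levi t y eq
... | inj₂ (r , refl , refl)     = y , r , y≢[] , refl
... | inj₁ ([] , y≡t++[] , refl) = y , [] , y≢[] , refl
... | inj₁ (r@(_ ∷ _) , y≡t++r , y≡r++s) =
  extend (conjugate⇒splits t r s (rs (subst (λ v → length r < length v) (sym y≡t++r) (length-++-<ʳ t t≢[])))
    (λ ()) t≢[] (trans (sym y≡t++r) y≡r++s))
  where
  -- Since y = x z x, the word `y ++ s` = `t ++ y` begins and ends with x. The two copies are
  -- disjoint because x is shorter than `t ++ x ++ z`.
  extend : Splits (λ x z → z ++ x) (r ++ s) → Splits (λ x z → z ++ x) (y ++ s)
  extend (x , z , x≢[] , xzx≡rs) with levi x (t ++ x ++ z) xzxs≡txzx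
    where
    open ≡-Reasoning
    y≡xzx : y ≡ x ++ (z ++ x)
    y≡xzx = trans y≡r++s (sym xzx≡rs)
    xzxs≡txzx : x ++ (z ++ x ++ s) ≡ (t ++ x ++ z) ++ x
    xzxs≡txzx = begin
      x ++ (z ++ x ++ s)   ≡⟨ solve (++-monoid (Fin k)) ⟩
      (x ++ (z ++ x)) ++ s ≡⟨ cong (_++ s) y≡xzx ⟨
      y ++ s               ≡⟨ eq ⟨
      t ++ y               ≡⟨ cong (t ++_) y≡xzx ⟩
      t ++ (x ++ (z ++ x)) ≡⟨ solve (++-monoid (Fin k)) ⟩
      (t ++ x ++ z) ++ x   ∎
  ... | inj₁ (q , txz≡xq , _) = x , q , x≢[] , (begin
      x ++ (q ++ x)        ≡⟨ ++-assoc x q x ⟨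
      (x ++ q) ++ x        ≡⟨ cong (_++ x) txz≡xq ⟨
      (t ++ x ++ z) ++ x   ≡⟨ solve (++-monoid (Fin k)) ⟩
      t ++ (x ++ (z ++ x)) ≡⟨ cong (t ++_) (trans xzx≡rs (sym y≡r++s)) ⟩
      t ++ y               ≡⟨ eq ⟩
      y ++ s               ∎)
    where open ≡-Reasoning
  ... | inj₂ (q , x≡txzq , _) = ⊥-elim (<⇒≢
    (<-≤-trans (length-++-<ʳ t t≢[]) (subst (length (t ++ x) ≤_) (sym (length-++ (t ++ x))) (m≤m+n _ _)))
    (cong length (trans x≡txzq (assoc t x z q))))
    where
    assoc : ∀ (t x z q : Word k) → (t ++ x ++ z) ++ q ≡ (t ++ x) ++ (z ++ q)
    assoc t x z q = solve (++-monoid (Fin k))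

borderSplitting : ∀ k → Splitting k
borderSplitting k = record
  { rest           = λ y z → z ++ y
  ; rest-length    = λ y z → trans (length-++ z) (+-comm (length z) (length y))
  ; rest-injective = λ y → ++-cancelʳ y _ _
  ; nested         = λ x z z′ → z ++ x ++ z′ ++ x ++ z , nested x z z′
  ; overlapping    = overlapping
  }
  where
  nested : ∀ (x z z′ : Word k) → x ++ ((z ++ x ++ z′ ++ x ++ z) ++ x) ≡ (x ++ (z ++ x)) ++ (z′ ++ (x ++ (z ++ x)))
  nested x z z′ = solve (++-monoid (Fin k))

  -- Both y and `y ++ s` end the common word, so y is a suffix as well as a prefix of `y ++ s`, and
  -- `conjugate⇒splits` applies.
  overlapping : ∀ (y s : Word k) {z z′} → y ≢ [] → s ≢ [] → y ++ (z ++ y) ≡ (y ++ s) ++ (z′ ++ (y ++ s)) →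
                Splits (λ x z → z ++ x) (y ++ s)
  overlapping y s {z} {z′} y≢[] s≢[] eq
    with levi z (s ++ z′) (++-cancelˡ y _ _ (trans eq (assoc y s z′)))
    where
    assoc : ∀ (y s z′ : Word k) → (y ++ s) ++ (z′ ++ (y ++ s)) ≡ y ++ ((s ++ z′) ++ (y ++ s))
    assoc y s z′ = solve (++-monoid (Fin k))
  ... | inj₁ (r , _ , y≡rys) = ⊥-elim (<⇒≢
    (<-≤-trans (length-++-<ˡ y s≢[]) (subst (length (y ++ s) ≤_) (sym (length-++ r)) (m≤n+m _ _)))
    (cong length y≡rys))
  ... | inj₂ ([] , _ , ys≡y) = ⊥-elim (<⇒≢ (length-++-<ˡ y s≢[]) (cong length (sym ys≡y)))
  ... | inj₂ (r@(_ ∷ _) , _ , ys≡ry) = conjugate⇒splits r y s (<-wellFounded _) y≢[] (λ ()) (sym ys≡ry)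

-- A word x z x has the border x. Conversely a border x gives w = x s = t x, and `conjugate⇒splits`
-- finds a border that does not overlap itself.
unbordered⇔free : (w : Word k) → (Unbordered w → Free (borderSplitting k) w) × (Free (borderSplitting k) w → Unbordered w)
unbordered⇔free {k} w = (λ unb s → unb (splits⇒border s)) , (λ free b → free (border⇒splits b))
  where
  splits⇒border : Splits (λ x z → z ++ x) w → ∃[ x ] Border x w
  splits⇒border (x , z , x≢[] , refl) =
    x , x≢[] , (λ eq → <⇒≢ (Splitting.length-factor-< (borderSplitting k) x z x≢[]) (cong length eq)) ,
    Prefix.fromView (≡⇒Pointwise-≡ refl Prefix.++ (z ++ x)) ,
    subst (Suffix.Suffix _≡_ x) (++-assoc x z x) (Suffix.fromView ((x ++ z) Suffix.++ ≡⇒Pointwise-≡ refl))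

  border⇒splits : (∃[ x ] Border x w) → Splits (λ x z → z ++ x) w
  border⇒splits (x , x≢[] , x≢w , pre , suf) with Prefix.toView pre
  ... | xs Prefix.++ s with refl ← Pointwise-≡⇒≡ xs = fromSuffix (Suffix.toView suf) refl
    where
    fromSuffix : ∀ {v} → Suffix.SuffixView _≡_ x v → v ≡ x ++ s → Splits (λ x z → z ++ x) (x ++ s)
    fromSuffix ([] Suffix.++ ys) eq with refl ← Pointwise-≡⇒≡ ys = ⊥-elim (x≢w eq)
    fromSuffix ((a ∷ t) Suffix.++ ys) eq with refl ← Pointwise-≡⇒≡ ys =
      conjugate⇒splits (a ∷ t) x s (<-wellFounded _) x≢[] (λ ()) eq

u≡count-free : ∀ k n → u k n ≡ count (free? (borderSplitting k)) n
u≡count-free k n = cong length (filter-≐ unbordered? (free? (borderSplitting k))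
  ((λ {w} → proj₁ (unbordered⇔free w)) , (λ {w} → proj₂ (unbordered⇔free w))) (words k n))

-- Palindromes

reverse-≢[] : {w : Word k} → w ≢ [] → reverse w ≢ []
reverse-≢[] {w = w} w≢[] eq = w≢[] (trans (sym (reverse-involutive w)) (cong reverse eq))

-- Cancelling s turns an instance for a into one for the shorter word r, where
-- a = s ++ r, with s replaced by its reversal.
palindromicPrefix : ∀ (a s : Word k) {z z′} → Acc _<_ (length a) → a ≢ [] → s ≢ [] →
                    a ++ z ≡ s ++ (reverse s ++ (a ++ z′)) → Splits (λ y t → reverse y ++ t) (reverse a ++ s)
palindromicPrefix {k} a s {z} {z′} (acc rs) a≢[] s≢[] eq with levi a s eq
-- If a is a prefix of s, then `reverse a ++ s` visibly begins with the even palindrome aᴿ a; the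
-- next case is a = s.
... | inj₁ (r , refl , _) = reverse a , r , reverse-≢[] a≢[] , cong (λ v → reverse a ++ (v ++ r)) (reverse-involutive a)
... | inj₂ ([] , refl , _) = reverse s , [] , reverse-≢[] s≢[] , (begin
  reverse s ++ (reverse (reverse s) ++ []) ≡⟨ cong (reverse s ++_) (trans (++-identityʳ _) (reverse-involutive s)) ⟩
  reverse s ++ s                           ≡⟨ cong (λ v → reverse v ++ s) (++-identityʳ s) ⟨
  reverse (s ++ []) ++ s                   ∎)
  where open ≡-Reasoning
... | inj₂ (r@(_ ∷ _) , refl , eq′)
  with y , t , y≢[] , eq″ ← palindromicPrefix r (reverse s) {z} {z′} (rs (length-++-<ʳ s s≢[])) (λ ()) (reverse-≢[] s≢[])
         (trans (sym eq′) (cong (reverse s ++_) (trans (++-assoc s r z′) (cong (_++ (r ++ z′)) (sym (reverse-involutive s)))))) =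
  -- The recursive call finds an even palindrome at the start of rᴿ sᴿ = aᴿ, hence at the start of
  -- aᴿ s.
  y , t ++ s , y≢[] , (begin
    y ++ (reverse y ++ (t ++ s))    ≡⟨ assoc y (reverse y) t s ⟩
    (y ++ (reverse y ++ t)) ++ s    ≡⟨ cong (_++ s) (trans eq″ (sym (reverse-++ s r))) ⟩
    reverse (s ++ r) ++ s           ∎)
  where
  open ≡-Reasoning
  assoc : ∀ (a b c d : Word k) → a ++ (b ++ (c ++ d)) ≡ (a ++ (b ++ c)) ++ d
  assoc a b c d = solve (++-monoid (Fin k))

palindromeSplitting : ∀ k → Splitting k
palindromeSplitting k = record
  { rest           = λ y z → reverse y ++ z
  ; rest-length    = λ y z → trans (length-++ (reverse y)) (cong (_+ length z) (length-reverse y))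
  ; rest-injective = λ y → ++-cancelˡ (reverse y) _ _
  ; nested         = λ x z z′ → let y = x ++ (reverse x ++ z) in
                       z ++ (reverse y ++ z′) , nested x (reverse x) z (reverse y ++ z′)
  ; overlapping    = overlapping
  }
  where
  nested : ∀ (a b c d : Word k) → a ++ (b ++ (c ++ d)) ≡ (a ++ (b ++ c)) ++ d
  nested a b c d = solve (++-monoid (Fin k))

  -- Cancelling y and writing a = yᴿ leaves a z = s sᴿ a z′, the hypothesis of `palindromicPrefix`,
  -- whose conclusion concerns aᴿ s = y s.
  overlapping : ∀ (y s : Word k) {z z′} → y ≢ [] → s ≢ [] →
                y ++ (reverse y ++ z) ≡ (y ++ s) ++ (reverse (y ++ s) ++ z′) →
                Splits (λ x z → reverse x ++ z) (y ++ s)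
  overlapping y s {z} {z′} y≢[] s≢[] eq =
    subst (λ v → Splits (λ x z → reverse x ++ z) (v ++ s)) (reverse-involutive y)
      (palindromicPrefix (reverse y) s (<-wellFounded _) (reverse-≢[] y≢[]) s≢[] (++-cancelˡ y _ _ (begin
        y ++ (reverse y ++ z)                       ≡⟨ eq ⟩
        (y ++ s) ++ (reverse (y ++ s) ++ z′)        ≡⟨ cong (λ v → (y ++ s) ++ (v ++ z′)) (reverse-++ y s) ⟩
        (y ++ s) ++ ((reverse s ++ reverse y) ++ z′) ≡⟨ assoc y s (reverse s) (reverse y) z′ ⟩
        y ++ (s ++ (reverse s ++ (reverse y ++ z′))) ∎)))
    where
    open ≡-Reasoning
    assoc : ∀ (a b c d e : Word k) → (a ++ b) ++ ((c ++ d) ++ e) ≡ a ++ (b ++ (c ++ (d ++ e)))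
    assoc a b c d e = solve (++-monoid (Fin k))

-- Factorisation of palstars into primes

palstar-∷ : ∀ (x : Word k) {z} → Palstar z → Palstar (x ++ (reverse x ++ z))
palstar-∷ []        ps                = ps
palstar-∷ x@(_ ∷ _) (ws , pws , refl) =
  (x ++ reverse x) ∷ ws , (x , (λ ()) , refl) ∷ pws , ++-assoc x (reverse x) (concat ws)

-- Here the remainder must stay a palstar. If x = y yᴿ t, then x xᴿ v = y yᴿ · t tᴿ · y yᴿ · v, so
-- the part after the first y yᴿ is again a palstar (t may be empty), and y is shorter than x.
palindrome-factor : ∀ (x : Word k) {v} → Acc _<_ (length x) → x ≢ [] → Palstar v →
                    ∃₂ λ y z → y ≢ [] × Free (palindromeSplitting k) y × Palstar z ×
                               y ++ (reverse y ++ z) ≡ x ++ (reverse x ++ v)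
palindrome-factor {k} x {v} (acc rs) x≢[] pv with Splitting.splits? (palindromeSplitting k) x
... | no  free = x , v , x≢[] , free , pv , refl
... | yes (y , t , y≢[] , refl)
    with y′ , z , y′≢[] , free , pz , eq ← palindrome-factor y
           (rs (Splitting.length-factor-< (palindromeSplitting k) y t y≢[])) y≢[]
           (palstar-∷ t (palstar-∷ y pv)) =
  y′ , z , y′≢[] , free , pz , trans eq (begin
    y ++ (reverse y ++ (t ++ (reverse t ++ (y ++ (reverse y ++ v))))) ≡⟨ assoc y (reverse y) t (reverse t) v ⟩
    (y ++ (reverse y ++ t)) ++ ((reverse t ++ (y ++ reverse y)) ++ v) ≡⟨ cong (λ r → (y ++ (reverse y ++ t)) ++ (r ++ v)) reversed ⟨
    (y ++ (reverse y ++ t)) ++ (reverse (y ++ (reverse y ++ t)) ++ v) ∎)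
  where
  open ≡-Reasoning
  assoc : ∀ (a b c d e : Word k) → a ++ (b ++ (c ++ (d ++ (a ++ (b ++ e))))) ≡ (a ++ (b ++ c)) ++ ((d ++ (a ++ b)) ++ e)
  assoc a b c d e = solve (++-monoid (Fin k))
  reversed : reverse (y ++ (reverse y ++ t)) ≡ reverse t ++ (y ++ reverse y)
  reversed = begin
    reverse (y ++ (reverse y ++ t))                 ≡⟨ reverse-++ y _ ⟩
    reverse (reverse y ++ t) ++ reverse y           ≡⟨ cong (_++ reverse y) (reverse-++ (reverse y) t) ⟩
    (reverse t ++ reverse (reverse y)) ++ reverse y ≡⟨ cong (λ r → (reverse t ++ r) ++ reverse y) (reverse-involutive y) ⟩
    (reverse t ++ y) ++ reverse y                   ≡⟨ ++-assoc (reverse t) y (reverse y) ⟩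
    reverse t ++ (y ++ reverse y)                   ∎

palstar-factor : ∀ {w : Word k} → w ≢ [] → Palstar w →
                 ∃₂ λ y z → y ≢ [] × Free (palindromeSplitting k) y × Palstar z × y ++ (reverse y ++ z) ≡ w
palstar-factor w≢[] ([] , [] , refl) = ⊥-elim (w≢[] refl)
palstar-factor w≢[] (_ ∷ ws , (x , x≢[] , refl) ∷ pws , refl)
  with y , z , y≢[] , free , pz , eq ← palindrome-factor x (<-wellFounded _) x≢[] (ws , pws , refl) =
  y , z , y≢[] , free , pz , trans eq (sym (++-assoc x (reverse x) (concat ws)))

-- The first prime factor y yᴿ has a free half y of length `suc i`, leaving a palstar of length 2(n
-- - i). By `count-free-unique` such halves are as numerous as the unbordered words of that length.
p-recurrence : ∀ k n → p k (suc n) ≡ sum (applyUpTo (λ i → u k (suc i) * p k (n ∸ i)) (suc n))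
p-recurrence k n = trans
  (Splitting.count-factorised S palstar? palstar? (2 * suc n) (suc n) (λ i → 2 * (n ∸ i))
    (λ |w|≡ → palstar-factor (length≢0 |w|≡))
    (λ y z _ _ → palstar-∷ y)
    (λ i l → mk⇔ (to i l) (from i l)))
  (sum-applyUpTo-cong (suc n) λ {i} _ → cong (_* p k (n ∸ i))
    (trans (count-free-unique S (borderSplitting k) (suc i)) (sym (u≡count-free k (suc i)))))
  where
  S = palindromeSplitting k

  double : ∀ m → m + m ≡ 2 * m
  double m = cong (λ v → m + v) (sym (+-identityʳ m))

  to : ∀ i l → i < suc n × l ≡ 2 * (n ∸ i) → suc i + (suc i + l) ≡ 2 * suc n
  to i _ (s≤s i≤n , refl) = begin
    suc i + (suc i + 2 * (n ∸ i))  ≡⟨ +-assoc (suc i) (suc i) _ ⟨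
    suc i + suc i + 2 * (n ∸ i)    ≡⟨ cong (_+ 2 * (n ∸ i)) (double (suc i)) ⟩
    2 * suc i + 2 * (n ∸ i)        ≡⟨ *-distribˡ-+ 2 (suc i) (n ∸ i) ⟨
    2 * (suc i + (n ∸ i))          ≡⟨ cong (λ m → 2 * suc m) (m+[n∸m]≡n i≤n) ⟩
    2 * suc n                      ∎
    where open ≡-Reasoning

  from : ∀ i l → suc i + (suc i + l) ≡ 2 * suc n → i < suc n × l ≡ 2 * (n ∸ i)
  from i l eq = *-cancelˡ-≤ 2 (subst (2 * suc i ≤_) eq′ (m≤m+n (2 * suc i) l)) , (begin
    l                         ≡⟨ m+n∸m≡n (2 * suc i) l ⟨
    2 * suc i + l ∸ 2 * suc i ≡⟨ cong (_∸ 2 * suc i) eq′ ⟩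
    2 * suc n ∸ 2 * suc i     ≡⟨ *-distribˡ-∸ 2 (suc n) (suc i) ⟨
    2 * (n ∸ i)               ∎)
    where
    open ≡-Reasoning
    eq′ : 2 * suc i + l ≡ 2 * suc n
    eq′ = trans (cong (_+ l) (sym (double (suc i)))) (trans (+-assoc (suc i) (suc i) l) eq)

-- Power series

open import Data.Integer.Base using (+_)
open RawMonoid ℤ.+-0-rawMonoid using () renaming (sum to ∑)

-- Replacing the index i by n - i exchanges the factors. `IsUnit` asks for a two-sided inverse, and
-- this supplies the second side.
⊛-comm : ∀ F G → F ⊛ G ≈ G ⊛ F
⊛-comm F G n = trans
  (sum-permute ℤ.+-0-commutativeMonoid (λ i → F (toℕ i) ℤ.* G (n ∸ toℕ i)) Perm.reverse)
  (sum-cong-≗ ℤ.+-0-monoid λ i → trans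
    (cong (λ j → F j ℤ.* G (n ∸ j)) (opposite-prop i))
    (trans (ℤ.*-comm (F (n ∸ toℕ i)) _)
      (cong (λ j → G j ℤ.* F (n ∸ toℕ i)) (m∸[m∸n]≡n (toℕ≤pred[n] i)))))

∑-neg : ∀ n (f : ℕ → ℤ) (g : ℕ → ℕ) → (∀ i → f i ≡ ℤ.- (+ g i)) →
        ∑ {n} (f ∘ toℕ) ≡ ℤ.- (+ sum (applyUpTo g n))
∑-neg zero    f g f≡-g = refl
∑-neg (suc n) f g f≡-g = trans (cong₂ ℤ._+_ (f≡-g 0) (∑-neg n (f ∘ suc) (g ∘ suc) (f≡-g ∘ suc)))
  (trans (sym (ℤ.neg-distrib-+ (+ g 0) _)) (cong ℤ.-_ (sym (ℤ.pos-+ (g 0) _))))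

[2-U]⊛P≈1 : ∀ k → (const (+ 2) - U k) ⊛ P k ≈ const 1ℤ
-- The decision procedures evaluate on the empty word to `u k 0` = `p k 0` = 1, and (2 - 1) · 1 = 1.
[2-U]⊛P≈1 k zero    = refl
[2-U]⊛P≈1 k (suc n) = begin
  -- The leading 1 is 2 - `u k 0`; the later coefficients of 2 - U are the negated `u k (suc i)`, so
  -- the recurrence for p cancels everything.
  1ℤ ℤ.* (+ p k (suc n)) ℤ.+ ∑ {suc n} (f ∘ toℕ)   ≡⟨ cong₂ ℤ._+_ (ℤ.*-identityˡ (+ p k (suc n))) (∑-neg (suc n) f _ f≡-g) ⟩
  (+ p k (suc n)) ℤ.- (+ sum (applyUpTo (λ i → u k (suc i) * p k (n ∸ i)) (suc n)))
                                                   ≡⟨ cong (λ m → (+ p k (suc n)) ℤ.- (+ m)) (p-recurrence k n) ⟨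
  (+ p k (suc n)) ℤ.- (+ p k (suc n))              ≡⟨ ℤ.+-inverseʳ (+ p k (suc n)) ⟩
  0ℤ                                               ∎
  where
  open ≡-Reasoning
  f : ℕ → ℤ
  f i = (0ℤ ℤ.- U k (suc i)) ℤ.* P k (n ∸ i)
  f≡-g : ∀ i → f i ≡ ℤ.- (+ (u k (suc i) * p k (n ∸ i)))
  f≡-g i = begin
    (0ℤ ℤ.- U k (suc i)) ℤ.* P k (n ∸ i)   ≡⟨ cong (ℤ._* P k (n ∸ i)) (ℤ.+-identityˡ (ℤ.- U k (suc i))) ⟩
    ℤ.- U k (suc i) ℤ.* P k (n ∸ i)        ≡⟨ ℤ.neg-distribˡ-* (U k (suc i)) (P k (n ∸ i)) ⟨
    ℤ.- (U k (suc i) ℤ.* P k (n ∸ i))      ≡⟨ cong ℤ.-_ (ℤ.pos-* (u k (suc i)) _) ⟨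
    ℤ.- (+ (u k (suc i) * p k (n ∸ i)))    ∎

theorem2 : (k : ℕ) → 2 ≤ k → Σ[ unit ∈ IsUnit (const (+ 2) - U k) ] P k ≈ 1/ (const (+ 2) - U k) unit
theorem2 k _ =
  -- The inverse supplied is `P k` itself, so the equation with `1/` holds by definition.
  (P k , (λ n → trans (⊛-comm (P k) (const (+ 2) - U k) n) ([2-U]⊛P≈1 k n)) , [2-U]⊛P≈1 k) , λ _ → refl
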